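{- Let $k,n$ be integers with $k\geq 4$ and $n\geq 1$. (1) If $4\leq k\leq 2^{\mathrm{R}_3(\mathcal{B}_n)+n}$, then $\mathrm{GR}_k(\mathcal{B}_2:\mathcal{B}_n)\leq \mathrm{R}_3(\mathcal{B}_n)+n$. (2) If $k>2^{\mathrm{R}_3(\mathcal{B}_n)+n}$, then the pair $(\mathcal{B}_2,\mathcal{B}_n)$ is $(\mathcal{B}_2:\mathcal{B}_n)_k$-good.
   Context: $\mathcal{B}_N$ denotes the Boolean lattice of all subsets of $[N]$ ordered by inclusion. An induced copy of a poset $\mathcal{P}$ in a poset $\mathcal{Q}$ is the image of an injection $f:\mathcal{P}\to\mathcal{Q}$ with $f(X)\le f(Y)$ iff $X\le Y$. A $k$-coloring of $\mathcal{B}_N$ is exact if it uses colors from $[k]$ and every color is used. Monochromatic: all sets share a color; rainbow: pairwise distinct colors. $\mathrm{R}_k(\mathcal{P})$ (Boolean Ramsey number) is the smallest $n$ such that every coloring of $\mathcal{B}_n$ with $k$ colors contains a monochromatic induced copy of $\mathcal{P}$. The pair $(\mathcal{Q},\mathcal{P})$ is $(\mathcal{Q}:\mathcal{P})_k$-good if for every positive integer $N$, every exact $k$-coloring of $\mathcal{B}_N$ contains a rainbow induced copy of $\mathcal{Q}$ or a monochromatic induced copy of $\mathcal{P}$. For a pair that is not good, $\mathrm{GR}_k(\mathcal{Q}:\mathcal{P})$ is the smallest integer $n$ such that for every $N\ge n$, every exact $k$-coloring of $\mathcal{B}_N$ contains a rainbow induced copy of $\mathcal{Q}$ or a monochromatic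 induced copy of $\mathcal{P}$. -}

module Defs where

open import Data.Fin.Base using (Fin)
open import Data.Fin.Subset using (Subset)
open import Data.Fin.Subset.Properties using (⊆-poset)
open import Data.Nat.Base using (ℕ; _≤_)
open import Data.Product.Base using (_×_; Σ-syntax)
open import Data.Sum.Base using (_⊎_)
open import Function.Base using (_∘_)
open import Function.Definitions using (Injective; StrictlySurjective)
open import Level using (0ℓ)
open import Relation.Binary.Bundles using (Poset)
open import Relation.Binary.Morphism.Structures using (IsOrderMonomorphism)
open import Relation.Binary.PropositionalEquality.Core using (_≡_)

Poset₀ : Set₁
Poset₀ = Poset 0ℓ 0ℓ 0ℓ

𝓑 : ℕ → Poset₀
𝓑 N = ⊆-poset N

-- The copy itself is the image of ⟦_⟧; `mono` and `cancel` of the monomorphism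
-- are the two directions of  f X ≤ f Y  iff  X ≤ Y.
record InducedCopy (P Q : Poset₀) : Set where
  private
    module P = Poset P
    module Q = Poset Q
  field
    ⟦_⟧                 : P.Carrier → Q.Carrier
    isOrderMonomorphism : IsOrderMonomorphism P._≈_ Q._≈_ P._≤_ Q._≤_ ⟦_⟧

  open IsOrderMonomorphism isOrderMonomorphism public

Coloring : ℕ → ℕ → Set
Coloring k N = Subset N → Fin k

Exact : ∀ {k N} → Coloring k N → Set
Exact c = StrictlySurjective _≡_ c

module _ {k N : ℕ} (c : Coloring k N) (P : Poset₀) where

  open InducedCopy

  Monochromatic : InducedCopy P (𝓑 N) → Set
  Monochromatic f = ∀ X Y → c (⟦ f ⟧ X) ≡ c (⟦ f ⟧ Y)

  Rainbow : InducedCopy P (𝓑 N) → Set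
  Rainbow f = Injective (Poset._≈_ P) _≡_ (c ∘ ⟦ f ⟧)

  HasMonochromaticCopy : Set
  HasMonochromaticCopy = Σ[ f ∈ InducedCopy P (𝓑 N) ] Monochromatic f

  HasRainbowCopy : Set
  HasRainbowCopy = Σ[ f ∈ InducedCopy P (𝓑 N) ] Rainbow f

IsLeast : (ℕ → Set) → ℕ → Set
IsLeast S n = S n × (∀ m → S m → n ≤ m)

-- IsR k P r  means  R_k(P) = r.
IsR : ℕ → Poset₀ → ℕ → Set
IsR k P = IsLeast λ n → (c : Coloring k n) → HasMonochromaticCopy c P

GallaiRamseyAt : ℕ → Poset₀ → Poset₀ → ℕ → Set
GallaiRamseyAt k Q P N =
  (c : Coloring k N) → Exact c → HasRainbowCopy c Q ⊎ HasMonochromaticCopy c P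

Good : ℕ → Poset₀ → Poset₀ → Set
Good k Q P = ∀ N → 1 ≤ N → GallaiRamseyAt k Q P N

-- IsGR k Q P g  means  GR_k(Q : P) = g.  The number is customarily considered
-- only for pairs that are not good; for a good pair the same least element is
-- at most 1, so the definition needs no case distinction.
IsGR : ℕ → Poset₀ → Poset₀ → ℕ → Set
IsGR k Q P = IsLeast λ n → ∀ N → n ≤ N → GallaiRamseyAt k Q P N

{-# OPTIONS --safe #-}

-- Let c be a colouring of 𝓑 N with N ≥ r + n and without a rainbow 𝓑 2, and let
-- a = c ⊤.  Fix an n-element set T.  Either every proper subset of T has colour
-- a, and then replacing T by ⊤ in the power set of T gives a monochromatic copy
-- of 𝓑 n; or some X of size less than n has a colour p ≠ a.  In the second case
-- let Z ⊇ X be minimal with a colour q outside {p, a} (Z = ⊤ if there is none)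
-- and pick x ∈ Z ∖ X.  A set S with X ⊆ S, x ∉ S and a fourth colour would be
-- incomparable to Z, so X, Z, S, ⊤ would be a rainbow 𝓑 2.  Hence these sets
-- form a Boolean lattice of dimension at least r using only the colours
-- p, a, q, and it contains a monochromatic 𝓑 n by the choice of r.
-- The least threshold exists constructively because the property at each N is
-- decidable; for N < r + n and k > 2 ^ (r + n) there is no exact colouring at all.

module Submission where

open import Defs
open import Data.Bool.Properties using () renaming (_≟_ to _≟ˢ_)
open import Data.Empty using (⊥-elim)
open import Data.Fin.Base using (Fin; zero; suc; combine)
open import Data.Fin.Properties using (_≟_; any?; all?; combine-injective; pigeonhole; <⇒≢)
open import Data.Fin.Subset
open import Data.Fin.Subset.Induction using (Acc; acc; ⊂-wellFounded)
open import Data.Fin.Subset.Properties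
open import Data.Nat.Base using (ℕ; zero; suc; _≤_; _<_; _+_; _^_; z≤n; s≤s; s≤s⁻¹)
open import Data.Nat.Properties as ℕ using (≤-trans; ≤-refl; +-suc; m≤n⇒m≤1+n)
open import Data.Product.Base using (_×_; _,_; proj₁; proj₂; ∃; ∃-syntax)
open import Data.Sum.Base as Sum using (_⊎_; inj₁; inj₂)
open import Data.Vec.Base using ([]; _∷_; here; there; lookup)
open import Data.Vec.Properties using (≡-dec)
open import Function.Base using (_∘_; id; const)
open import Relation.Binary.Morphism.Construct.Composition using (isOrderMonomorphism)
open import Relation.Binary.PropositionalEquality
  using (_≡_; _≢_; _≗_; refl; sym; trans; cong; subst; subst₂; ≢-sym)
open import Relation.Nullary.Decidable
  using (Dec; yes; no; map′; ¬?; _×-dec_; _⊎-dec_; _→-dec_; decidable-stable)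
open import Relation.Nullary.Negation using (¬_; contradiction)
open import Relation.Unary using (Decidable)

private
  variable
    k m n r N : ℕ

-- Finite subsets: inclusion, minimal elements, cardinality.

infix 4 _≟ₛ_
_≟ₛ_ : (X Y : Subset N) → Dec (X ≡ Y)
_≟ₛ_ = ≡-dec _≟ˢ_

⊈⇒∃∈∉ : (X Y : Subset N) → Y ⊈ X → ∃[ x ] x ∈ Y × x ∉ X
⊈⇒∃∈∉ X Y Y⊈X with any? (λ x → (x ∈? Y) ×-dec ¬? (x ∈? X))
... | yes found = found
... | no none = contradiction (λ {x} x∈Y → decidable-stable (x ∈? X) λ x∉X → none (x , x∈Y , x∉X)) Y⊈X

⊆∧≢⇒⊂ : {X Y : Subset N} → X ⊆ Y → X ≢ Y → X ⊂ Y
⊆∧≢⇒⊂ {X = X} {Y} X⊆Y X≢Y = X⊆Y , ⊈⇒∃∈∉ X Y λ Y⊆X → X≢Y (⊆-antisym X⊆Y Y⊆X)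

-- Descent along the well-founded `⊂`: at each stage a finite search either finds a strictly smaller
-- witness or certifies that there is none.
minimal : {P : Subset N → Set} → Decidable P → ∀ X → P X →
          ∃[ Z ] P Z × (∀ {S} → S ⊂ Z → ¬ P S)
minimal {P = P} P? X = go X (⊂-wellFounded X)
  where
  go : ∀ X → Acc _⊂_ X → P X → ∃[ Z ] P Z × (∀ {S} → S ⊂ Z → ¬ P S)
  go X (acc rec) PX with anySubset? (λ S → (S ⊆? X) ×-dec ¬? (S ≟ₛ X) ×-dec P? S)
  ... | yes (S , S⊆X , S≢X , PS) = go S (rec (⊆∧≢⇒⊂ S⊆X S≢X)) PS
  ... | no none = X , PX , λ {S} S⊂X PS →
    none (S , p⊂q⇒p⊆q S⊂X , (λ { refl → ⊂-irref refl S⊂X }) , PS)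

∣p∪q∣≤∣p∣+∣q∣ : (p q : Subset N) → ∣ p ∪ q ∣ ≤ ∣ p ∣ + ∣ q ∣
∣p∪q∣≤∣p∣+∣q∣ [] [] = z≤n
∣p∪q∣≤∣p∣+∣q∣ (outside ∷ p) (outside ∷ q) = ∣p∪q∣≤∣p∣+∣q∣ p q
∣p∪q∣≤∣p∣+∣q∣ (outside ∷ p) (inside ∷ q) rewrite +-suc ∣ p ∣ ∣ q ∣ = s≤s (∣p∪q∣≤∣p∣+∣q∣ p q)
∣p∪q∣≤∣p∣+∣q∣ (inside ∷ p) (s ∷ q) =
  s≤s (≤-trans (∣p∪q∣≤∣p∣+∣q∣ p q) (ℕ.+-monoʳ-≤ ∣ p ∣ (∣p∣≤∣x∷p∣ s q)))

-- Embedding a Boolean lattice with prescribed positions.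

private
  -- The head inclusion and the tail inclusion come from different pairs of sets, so that both
  -- `weave-mono` and `weave-cancel` can use it.
  bit : {p q : Subset m} {p′ q′ : Subset n} {s t : Side} →
        s ∷ p ⊆ t ∷ q → p′ ⊆ q′ → s ∷ p′ ⊆ t ∷ q′
  bit {s = inside} h p⊆q here with here ← h here = here
  bit h p⊆q (there x∈p) = there (p⊆q x∈p)

-- The set that agrees with A on U and whose trace outside U lists the bits of S
-- in order; positions left over once S is exhausted are again filled from A.
weave : Subset N → Subset N → Subset r → Subset N
weave [] [] S = []
weave (inside ∷ U) (a ∷ A) S = a ∷ weave U A S
weave (outside ∷ U) (a ∷ A) [] = a ∷ weave U A []
weave (outside ∷ U) (a ∷ A) (s ∷ S) = s ∷ weave U A S

weave-mono : (U A : Subset N) {S S′ : Subset r} → S ⊆ S′ → weave U A S ⊆ weave U A S′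
weave-mono [] [] S⊆S′ ()
weave-mono (inside ∷ U) (a ∷ A) S⊆S′ = s⊆s (weave-mono U A S⊆S′)
weave-mono (outside ∷ U) (a ∷ A) {[]} {[]} S⊆S′ = id
weave-mono (outside ∷ U) (a ∷ A) {_ ∷ _} {_ ∷ _} S⊆S′ =
  bit S⊆S′ (weave-mono U A (drop-∷-⊆ S⊆S′))

-- The bound leaves at least `r` positions outside `U`, so every bit of `S` is written somewhere and
-- can be read back.
weave-cancel : (U A : Subset N) {S S′ : Subset r} → r + ∣ U ∣ ≤ N →
               weave U A S ⊆ weave U A S′ → S ⊆ S′
weave-cancel [] [] {_ ∷ _} () _
weave-cancel [] [] {[]} _ _ ()
weave-cancel {r = r} (inside ∷ U) (a ∷ A) room W⊆W′
  rewrite +-suc r ∣ U ∣ = weave-cancel U A (s≤s⁻¹ room) (drop-∷-⊆ W⊆W′)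
weave-cancel (outside ∷ U) (a ∷ A) {[]} _ _ ()
weave-cancel (outside ∷ U) (a ∷ A) {_ ∷ _} {_ ∷ _} room W⊆W′ =
  bit W⊆W′ (weave-cancel U A (s≤s⁻¹ room) (drop-∷-⊆ W⊆W′))

-- Positions outside `U` may be overwritten; `A` survives because it has no element there.
⊆-weave : (U A : Subset N) (S : Subset r) → A ⊆ U → A ⊆ weave U A S
⊆-weave (inside ∷ U) (a ∷ A) S A⊆U = s⊆s (⊆-weave U A S (drop-∷-⊆ A⊆U))
⊆-weave (outside ∷ U) (a ∷ A) [] A⊆U = s⊆s (⊆-weave U A [] (drop-∷-⊆ A⊆U))
⊆-weave (outside ∷ U) (inside ∷ A) (s ∷ S) A⊆U with () ← A⊆U here
⊆-weave (outside ∷ U) (outside ∷ A) (s ∷ S) A⊆U = out⊆ (⊆-weave U A S (drop-∷-⊆ A⊆U))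

weave-agrees : (U A : Subset N) (S : Subset r) → ∀ {x} → x ∈ U → x ∈ weave U A S → x ∈ A
weave-agrees (inside ∷ U) (a ∷ A) S here here = here
weave-agrees (inside ∷ U) (a ∷ A) S (there x∈U) (there x∈W) = there (weave-agrees U A S x∈U x∈W)
weave-agrees (outside ∷ U) (a ∷ A) [] (there x∈U) (there x∈W) = there (weave-agrees U A [] x∈U x∈W)
weave-agrees (outside ∷ U) (a ∷ A) (s ∷ S) (there x∈U) (there x∈W) = there (weave-agrees U A S x∈U x∈W)

∣weave∣≤ : (U A : Subset N) (S : Subset r) → ∣ weave U A S ∣ ≤ ∣ S ∣ + ∣ A ∣
∣weave∣≤ [] [] S = z≤n
∣weave∣≤ (inside ∷ U) (outside ∷ A) S = ∣weave∣≤ U A S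
∣weave∣≤ (inside ∷ U) (inside ∷ A) S rewrite +-suc ∣ S ∣ ∣ A ∣ = s≤s (∣weave∣≤ U A S)
∣weave∣≤ (outside ∷ U) (outside ∷ A) [] = ∣weave∣≤ U A []
∣weave∣≤ (outside ∷ U) (inside ∷ A) [] = s≤s (∣weave∣≤ U A [])
∣weave∣≤ (outside ∷ U) (a ∷ A) (outside ∷ S) =
  ≤-trans (∣weave∣≤ U A S) (ℕ.+-monoʳ-≤ ∣ S ∣ (∣p∣≤∣x∷p∣ a A))
∣weave∣≤ (outside ∷ U) (a ∷ A) (inside ∷ S) =
  s≤s (≤-trans (∣weave∣≤ U A S) (ℕ.+-monoʳ-≤ ∣ S ∣ (∣p∣≤∣x∷p∣ a A)))

-- Induced copies and transfer of monochromatic ones.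

inducedCopy : (f : Subset m → Subset N) →
              (∀ {X Y} → X ⊆ Y → f X ⊆ f Y) → (∀ {X Y} → f X ⊆ f Y → X ⊆ Y) →
              InducedCopy (𝓑 m) (𝓑 N)
inducedCopy f mono cancel = record
  { ⟦_⟧ = f
  ; isOrderMonomorphism = record
    { isOrderHomomorphism = record { cong = cong f ; mono = mono }
    ; injective = λ fX≡fY →
        ⊆-antisym (cancel (⊆-reflexive fX≡fY)) (cancel (⊆-reflexive (sym fX≡fY)))
    ; cancel = cancel
    }
  }

open InducedCopy using (⟦_⟧)

-- Instead of being the pullback of `c` along `g`, `d` may be any refinement of it, with its own set
-- of colours.
mono-∘ : {P : Poset₀} (c : Coloring k N) (g : InducedCopy (𝓑 r) (𝓑 N)) (d : Coloring m r) →
         (∀ S T → d S ≡ d T → c (⟦ g ⟧ S) ≡ c (⟦ g ⟧ T)) →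
         HasMonochromaticCopy d P → HasMonochromaticCopy c P
mono-∘ c g d d⇒c (f , f-mono) =
  record
    { ⟦_⟧ = ⟦ g ⟧ ∘ ⟦ f ⟧
    ; isOrderMonomorphism = isOrderMonomorphism
        (InducedCopy.isOrderMonomorphism f) (InducedCopy.isOrderMonomorphism g)
    } ,
  λ X Y → d⇒c (⟦ f ⟧ X) (⟦ f ⟧ Y) (f-mono X Y)

-- Weaving over `U = X ∪ ⁅ x ⁆` with background `X` keeps `X` inside and `x` outside, and leaves at
-- least `r` free positions. Colouring by palette indices allows `palette` to repeat colours.
mono-in-palette : {P : Poset₀} (c : Coloring k N) →
  ((d : Coloring m r) → HasMonochromaticCopy d P) →
  (X : Subset N) (x : Fin N) → x ∉ X → r + suc ∣ X ∣ ≤ N →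
  (palette : Fin m → Fin k) →
  (∀ S → X ⊆ S → x ∉ S → ∃[ i ] c S ≡ palette i) →
  HasMonochromaticCopy c P
mono-in-palette {N = N} {m} {r} c ramsey X x x∉X room palette colour =
  mono-∘ c g d (λ S T dS≡dT → trans (proj₂ (index S)) (trans (cong palette dS≡dT) (sym (proj₂ (index T)))))
    (ramsey d)
  where
  U : Subset N
  U = X ∪ ⁅ x ⁆

  ∣U∣≤ : ∣ U ∣ ≤ suc ∣ X ∣
  ∣U∣≤ = ≤-trans (∣p∪q∣≤∣p∣+∣q∣ X ⁅ x ⁆)
    (ℕ.≤-reflexive (trans (cong (∣ X ∣ +_) (∣⁅x⁆∣≡1 x)) (ℕ.+-comm ∣ X ∣ 1)))

  g : InducedCopy (𝓑 r) (𝓑 N)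
  g = inducedCopy (weave U X) (weave-mono U X)
    (weave-cancel U X (≤-trans (ℕ.+-monoʳ-≤ r ∣U∣≤) room))

  index : ∀ S → ∃[ i ] c (weave U X S) ≡ palette i
  index S = colour (weave U X S) (⊆-weave U X S (p⊆p∪q ⁅ x ⁆))
    (x∉X ∘ weave-agrees U X S (q⊆p∪q X ⁅ x ⁆ (x∈⁅x⁆ x)))

  d : Coloring m r
  d = proj₁ ∘ index

-- Rainbow copies of `𝓑 2`.

-- Incomparability of `B` and `C` forces the remaining non-inclusions: for instance, `D ⊆ B` would
-- give `C ⊆ D ⊆ B`.
diamond : (A B C D : Subset N) → A ⊆ B → A ⊆ C → B ⊆ D → C ⊆ D → B ⊈ C → C ⊈ B →
          InducedCopy (𝓑 2) (𝓑 N)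
diamond {N} A B C D A⊆B A⊆C B⊆D C⊆D B⊈C C⊈B =
  inducedCopy f (λ {X} {Y} → mono X Y) (λ {X} {Y} → cancel X Y)
  where
  f : Subset 2 → Subset N
  f (outside ∷ outside ∷ []) = A
  f (inside  ∷ outside ∷ []) = B
  f (outside ∷ inside  ∷ []) = C
  f (inside  ∷ inside  ∷ []) = D

  mono : ∀ X Y → X ⊆ Y → f X ⊆ f Y
  mono (outside ∷ outside ∷ []) (outside ∷ outside ∷ []) _ = id
  mono (outside ∷ outside ∷ []) (inside  ∷ outside ∷ []) _ = A⊆B
  mono (outside ∷ outside ∷ []) (outside ∷ inside  ∷ []) _ = A⊆C
  mono (outside ∷ outside ∷ []) (inside  ∷ inside  ∷ []) _ = B⊆D ∘ A⊆B
  mono (inside  ∷ outside ∷ []) (inside  ∷ outside ∷ []) _ = id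
  mono (inside  ∷ outside ∷ []) (inside  ∷ inside  ∷ []) _ = B⊆D
  mono (outside ∷ inside  ∷ []) (outside ∷ inside  ∷ []) _ = id
  mono (outside ∷ inside  ∷ []) (inside  ∷ inside  ∷ []) _ = C⊆D
  mono (inside  ∷ inside  ∷ []) (inside  ∷ inside  ∷ []) _ = id
  mono (inside  ∷ _       ∷ []) (outside ∷ _       ∷ []) X⊆Y with () ← X⊆Y here
  mono (_       ∷ inside  ∷ []) (_       ∷ outside ∷ []) X⊆Y with there () ← X⊆Y (there here)

  cancel : ∀ X Y → f X ⊆ f Y → X ⊆ Y
  cancel (outside ∷ outside ∷ []) _ _ = ⊥⊆
  cancel _ (inside ∷ inside ∷ []) _ = ⊆⊤
  cancel (inside  ∷ outside ∷ []) (inside  ∷ outside ∷ []) _ = id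
  cancel (outside ∷ inside  ∷ []) (outside ∷ inside  ∷ []) _ = id
  cancel (inside  ∷ outside ∷ []) (outside ∷ outside ∷ []) B⊆A = ⊥-elim (B⊈C (A⊆C ∘ B⊆A))
  cancel (inside  ∷ outside ∷ []) (outside ∷ inside  ∷ []) B⊆C = ⊥-elim (B⊈C B⊆C)
  cancel (outside ∷ inside  ∷ []) (outside ∷ outside ∷ []) C⊆A = ⊥-elim (C⊈B (A⊆B ∘ C⊆A))
  cancel (outside ∷ inside  ∷ []) (inside  ∷ outside ∷ []) C⊆B = ⊥-elim (C⊈B C⊆B)
  cancel (inside  ∷ inside  ∷ []) (outside ∷ outside ∷ []) D⊆A = ⊥-elim (B⊈C (A⊆C ∘ D⊆A ∘ B⊆D))
  cancel (inside  ∷ inside  ∷ []) (inside  ∷ outside ∷ []) D⊆B = ⊥-elim (C⊈B (D⊆B ∘ C⊆D))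
  cancel (inside  ∷ inside  ∷ []) (outside ∷ inside  ∷ []) D⊆C = ⊥-elim (B⊈C (D⊆C ∘ B⊆D))

rainbow-diamond : (c : Coloring k N) {A B C D : Subset N} →
  A ⊆ B → A ⊆ C → B ⊆ D → C ⊆ D → B ⊈ C → C ⊈ B →
  c A ≢ c B → c A ≢ c C → c A ≢ c D → c B ≢ c C → c B ≢ c D → c C ≢ c D →
  HasRainbowCopy c (𝓑 2)
rainbow-diamond c {A} {B} {C} {D} A⊆B A⊆C B⊆D C⊆D B⊈C C⊈B A≢B A≢C A≢D B≢C B≢D C≢D =
  copy , λ {X} {Y} → injective X Y
  where
  copy = diamond A B C D A⊆B A⊆C B⊆D C⊆D B⊈C C⊈B

  injective : ∀ X Y → c (⟦ copy ⟧ X) ≡ c (⟦ copy ⟧ Y) → X ≡ Y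
  injective (outside ∷ outside ∷ []) (outside ∷ outside ∷ []) _ = refl
  injective (inside  ∷ outside ∷ []) (inside  ∷ outside ∷ []) _ = refl
  injective (outside ∷ inside  ∷ []) (outside ∷ inside  ∷ []) _ = refl
  injective (inside  ∷ inside  ∷ []) (inside  ∷ inside  ∷ []) _ = refl
  injective (outside ∷ outside ∷ []) (inside  ∷ outside ∷ []) e = contradiction e A≢B
  injective (outside ∷ outside ∷ []) (outside ∷ inside  ∷ []) e = contradiction e A≢C
  injective (outside ∷ outside ∷ []) (inside  ∷ inside  ∷ []) e = contradiction e A≢D
  injective (inside  ∷ outside ∷ []) (outside ∷ inside  ∷ []) e = contradiction e B≢C
  injective (inside  ∷ outside ∷ []) (inside  ∷ inside  ∷ []) e = contradiction e B≢D
  injective (outside ∷ inside  ∷ []) (inside  ∷ inside  ∷ []) e = contradiction e C≢D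
  injective (inside  ∷ outside ∷ []) (outside ∷ outside ∷ []) e = contradiction (sym e) A≢B
  injective (outside ∷ inside  ∷ []) (outside ∷ outside ∷ []) e = contradiction (sym e) A≢C
  injective (inside  ∷ inside  ∷ []) (outside ∷ outside ∷ []) e = contradiction (sym e) A≢D
  injective (outside ∷ inside  ∷ []) (inside  ∷ outside ∷ []) e = contradiction (sym e) B≢C
  injective (inside  ∷ inside  ∷ []) (inside  ∷ outside ∷ []) e = contradiction (sym e) B≢D
  injective (inside  ∷ inside  ∷ []) (outside ∷ inside  ∷ []) e = contradiction (sym e) C≢D

-- The rainbow or monochromatic dichotomy in large dimension.

module _ {P : Poset₀} (ramsey : (d : Coloring 3 r) → HasMonochromaticCopy d P) where

  private
    -- The alternative S ≡ ⊤ makes a minimal such set exist in all cases.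
    New : Coloring k N → Subset N → Subset N → Set
    New c X S = X ⊆ S × c S ≢ c X × (c S ≢ c ⊤ ⊎ S ≡ ⊤)

    New? : (c : Coloring k N) (X : Subset N) → Decidable (New c X)
    New? c X S = (X ⊆? S) ×-dec ¬? (c S ≟ c X) ×-dec (¬? (c S ≟ c ⊤) ⊎-dec (S ≟ₛ ⊤))

  rainbow-or-mono-above : (c : Coloring k N) (X : Subset N) → r + suc ∣ X ∣ ≤ N → c X ≢ c ⊤ →
                          HasRainbowCopy c (𝓑 2) ⊎ HasMonochromaticCopy c P
  rainbow-or-mono-above {k} {N} c X room cX≢c⊤
    with Z , (X⊆Z , cZ≢cX , cZ≢c⊤⊎Z≡⊤) , Z-min ← minimal (New? c X) ⊤ (⊆⊤ , ≢-sym cX≢c⊤ , inj₂ refl)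
    with x , x∈Z , x∉X ← ⊈⇒∃∈∉ X Z (λ Z⊆X → cZ≢cX (cong c (⊆-antisym Z⊆X X⊆Z)))
    with anySubset? (λ S → (X ⊆? S) ×-dec ¬? (x ∈? S) ×-dec
                           ¬? (c S ≟ c X) ×-dec ¬? (c S ≟ c ⊤) ×-dec ¬? (c S ≟ c Z))
  ... | yes (S , X⊆S , x∉S , cS≢cX , cS≢c⊤ , cS≢cZ) =
    inj₁ (rainbow-diamond c X⊆Z X⊆S ⊆⊤ ⊆⊤ (λ Z⊆S → x∉S (Z⊆S x∈Z)) S⊈Z
      (≢-sym cZ≢cX) (≢-sym cS≢cX) cX≢c⊤ (≢-sym cS≢cZ) cZ≢c⊤ cS≢c⊤)
    where
    -- The element `x` makes an inclusion `S ⊆ Z` strict, and `S` satisfies `New`, so minimality of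
    -- `Z` excludes it.
    S⊈Z : S ⊈ Z
    S⊈Z S⊆Z = Z-min (S⊆Z , x , x∈Z , x∉S) (X⊆S , cS≢cX , inj₁ cS≢c⊤)

    -- If `Z` were `⊤`, it would contain `S`, against `S⊈Z`; so the other alternative in `New`
    -- holds.
    cZ≢c⊤ : c Z ≢ c ⊤
    cZ≢c⊤ = Sum.[ id , (λ { refl → ⊥-elim (S⊈Z ⊆⊤) }) ] cZ≢c⊤⊎Z≡⊤
  ... | no none = inj₂ (mono-in-palette c ramsey X x x∉X room palette colour)
    where
    -- Entries may coincide, as they do when `Z` is `⊤`.
    palette : Fin 3 → Fin k
    palette = lookup (c X ∷ c ⊤ ∷ c Z ∷ [])

    colour : ∀ S → X ⊆ S → x ∉ S → ∃[ i ] c S ≡ palette i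
    colour S X⊆S x∉S = decidable-stable (any? λ i → c S ≟ palette i) λ other →
      none (S , X⊆S , x∉S , (other ∘ (zero ,_)) , (other ∘ (suc zero ,_)) , (other ∘ (suc (suc zero) ,_)))

rainbow-or-mono : ((d : Coloring 3 r) → HasMonochromaticCopy d (𝓑 n)) → r + n ≤ N →
                  (c : Coloring k N) → HasRainbowCopy c (𝓑 2) ⊎ HasMonochromaticCopy c (𝓑 n)
rainbow-or-mono {r} {n} {N} ramsey r+n≤N c
  -- `weave ⊥ ⊥ A` places `A` on the first `n` of the `N` positions and leaves the others empty.
  with anySubset? (λ A → ¬? (A ≟ₛ ⊤) ×-dec ¬? (c (weave ⊥ ⊥ A) ≟ c ⊤))
... | yes (A , A≢⊤ , cX≢c⊤) = rainbow-or-mono-above ramsey c (weave ⊥ ⊥ A) room cX≢c⊤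
  where
  -- The strict inequality supplies the one extra position taken by the excluded element in
  -- `rainbow-or-mono-above`.
  ∣X∣<n : ∣ weave {N} ⊥ ⊥ A ∣ < n
  ∣X∣<n = ℕ.≤-<-trans (∣weave∣≤ {N} ⊥ ⊥ A)
    (subst (_< n) (sym (trans (cong (∣ A ∣ +_) (∣⊥∣≡0 N)) (ℕ.+-identityʳ _)))
      (ℕ.≤∧≢⇒< (∣p∣≤n A) (A≢⊤ ∘ ∣p∣≡n⇒p≡⊤)))

  room : r + suc ∣ weave {N} ⊥ ⊥ A ∣ ≤ N
  room = ≤-trans (ℕ.+-monoʳ-≤ r ∣X∣<n) r+n≤N
... | no none = inj₂ (inducedCopy (λ A → f A (A ≟ₛ ⊤)) (λ {A} {B} → mono (A ≟ₛ ⊤) (B ≟ₛ ⊤))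
                        (λ {A} {B} → cancel (A ≟ₛ ⊤) (B ≟ₛ ⊤)) ,
                      λ A B → trans (colour A (A ≟ₛ ⊤)) (sym (colour B (B ≟ₛ ⊤))))
  where
  -- The decision is an explicit argument so that the proofs below can split on it by matching.
  f : (A : Subset n) → Dec (A ≡ ⊤) → Subset N
  f A (yes _) = ⊤
  f A (no _) = weave ⊥ ⊥ A

  weave-cancel-⊥ : {A B : Subset n} → weave {N} ⊥ ⊥ A ⊆ weave ⊥ ⊥ B → A ⊆ B
  weave-cancel-⊥ = weave-cancel ⊥ ⊥ (subst (λ z → n + z ≤ N) (sym (∣⊥∣≡0 N))
    (subst (_≤ N) (sym (ℕ.+-identityʳ n)) (≤-trans (ℕ.m≤n+m n r) r+n≤N)))

  mono : ∀ {A B} (A? : Dec (A ≡ ⊤)) (B? : Dec (B ≡ ⊤)) → A ⊆ B → f A A? ⊆ f B B?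
  mono A? (yes _) A⊆B = ⊆⊤
  mono (yes refl) (no B≢⊤) A⊆B = contradiction (⊆-antisym ⊆⊤ A⊆B) B≢⊤
  mono (no _) (no _) A⊆B = weave-mono ⊥ ⊥ A⊆B

  cancel : ∀ {A B} (A? : Dec (A ≡ ⊤)) (B? : Dec (B ≡ ⊤)) → f A A? ⊆ f B B? → A ⊆ B
  cancel A? (yes refl) fA⊆fB = ⊆⊤
  -- The image of `A` is `⊤`, which contains `weave ⊥ ⊥ A`; so cancellation for woven sets still
  -- applies.
  cancel (yes _) (no _) fA⊆fB = weave-cancel-⊥ (⊆-trans ⊆⊤ fA⊆fB)
  cancel (no _) (no _) fA⊆fB = weave-cancel-⊥ fA⊆fB

  colour : ∀ A (A? : Dec (A ≡ ⊤)) → c (f A A?) ≡ c ⊤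
  colour A (yes _) = refl
  colour A (no A≢⊤) = decidable-stable (_ ≟ _) λ cX≢c⊤ → none (A , A≢⊤ , cX≢c⊤)

-- Deciding the Gallai–Ramsey property at a fixed dimension

∀Subset? : {P : Subset N → Set} → Decidable P → Dec (∀ X → P X)
∀Subset? P? = map′ (λ none X → decidable-stable (P? X) λ ¬PX → none (X , ¬PX))
  (λ all (X , ¬PX) → ¬PX (all X)) (¬? (anySubset? (¬? ∘ P?)))

-- Without function extensionality only predicates invariant under pointwise
-- equality can be searched.
anyFunction? : {B : Set} → (∀ {Q : B → Set} → Decidable Q → Dec (∃ Q)) →
               {P : (Subset m → B) → Set} → (∀ {f g} → f ≗ g → P f → P g) →
               Decidable P → Dec (∃ P)
anyFunction? {zero} any-B? resp P? =
  map′ (λ (b , Pb) → const b , Pb)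
       (λ (f , Pf) → f [] , resp (λ { [] → refl }) Pf)
       (any-B? (P? ∘ const))
anyFunction? {suc m} {B} any-B? {P} resp P? =
  map′ (λ (g , h , Pgh) → join g h , Pgh)
       (λ (f , Pf) → f ∘ (inside ∷_) , f ∘ (outside ∷_) ,
          resp (λ { (inside ∷ _) → refl ; (outside ∷ _) → refl }) Pf)
       -- A function on `Subset (suc m)` is a pair of functions on `Subset m`, one for each value of
       -- the first bit; hence two nested searches.
       (anyFunction? any-B?
         (λ g≗g′ (h , Pgh) → h , resp (join-cong g≗g′ λ _ → refl) Pgh)
         λ g → anyFunction? any-B? (λ h≗h′ → resp (join-cong (λ _ → refl) h≗h′)) λ h → P? (join g h))
  where
  join : (Subset m → B) → (Subset m → B) → Subset (suc m) → B
  join g h (inside ∷ S) = g S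
  join g h (outside ∷ S) = h S

  join-cong : ∀ {g g′ h h′} → g ≗ g′ → h ≗ h′ → join g h ≗ join g′ h′
  join-cong g≗g′ h≗h′ (inside ∷ S) = g≗g′ S
  join-cong g≗g′ h≗h′ (outside ∷ S) = h≗h′ S

-- The search runs over bare functions satisfying `Embeds`; antisymmetry of inclusion then recovers
-- the injectivity that the record asks for.
inducedCopy? : {Q : (Subset m → Subset N) → Set} → (∀ {f g} → f ≗ g → Q f → Q g) →
               Decidable Q → Dec (∃[ f ] Q (⟦_⟧ {𝓑 m} {𝓑 N} f))
inducedCopy? {m} {N} {Q} resp Q? =
  map′ (λ (f , f-emb , Qf) →
          inducedCopy f (λ {X} {Y} → proj₁ (f-emb X Y)) (λ {X} {Y} → proj₂ (f-emb X Y)) , Qf)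
       (λ (f , Qf) → ⟦ f ⟧ , copy⇒embeds f , Qf)
       (anyFunction? anySubset?
         (λ f≗g (f-emb , Qf) → embeds-resp f≗g f-emb , resp f≗g Qf)
         λ f → embeds? f ×-dec Q? f)
  where
  Embeds : (Subset m → Subset N) → Set
  Embeds f = ∀ X Y → (X ⊆ Y → f X ⊆ f Y) × (f X ⊆ f Y → X ⊆ Y)

  copy⇒embeds : (f : InducedCopy (𝓑 m) (𝓑 N)) → Embeds ⟦ f ⟧
  copy⇒embeds f X Y =
    (λ X⊆Y → InducedCopy.mono f {X} {Y} X⊆Y) ,
    (λ fX⊆fY → InducedCopy.cancel f {X} {Y} fX⊆fY)

  embeds? : Decidable Embeds
  embeds? f = ∀Subset? λ X → ∀Subset? λ Y →
    ((X ⊆? Y) →-dec (f X ⊆? f Y)) ×-dec ((f X ⊆? f Y) →-dec (X ⊆? Y))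

  embeds-resp : ∀ {f g} → f ≗ g → Embeds f → Embeds g
  embeds-resp f≗g f-emb X Y =
    (λ X⊆Y → subst₂ _⊆_ (f≗g X) (f≗g Y) (proj₁ (f-emb X Y) X⊆Y)) ,
    (λ gX⊆gY → proj₂ (f-emb X Y) (subst₂ _⊆_ (sym (f≗g X)) (sym (f≗g Y)) gX⊆gY))

hasMonochromaticCopy? : (c : Coloring k N) → Dec (HasMonochromaticCopy c (𝓑 m))
hasMonochromaticCopy? c = inducedCopy?
  (λ f≗g f-mono X Y → trans (sym (cong c (f≗g X))) (trans (f-mono X Y) (cong c (f≗g Y))))
  λ f → ∀Subset? λ X → ∀Subset? λ Y → c (f X) ≟ c (f Y)

hasRainbowCopy? : (c : Coloring k N) → Dec (HasRainbowCopy c (𝓑 m))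
hasRainbowCopy? c = inducedCopy?
  (λ f≗g f-inj gX≡gY → f-inj (trans (cong c (f≗g _)) (trans gX≡gY (sym (cong c (f≗g _))))))
  λ f → map′ (λ inj {X} {Y} → inj X Y) (λ inj X Y → inj)
    (∀Subset? λ X → ∀Subset? λ Y → (c (f X) ≟ c (f Y)) →-dec (X ≟ₛ Y))

-- Decided by searching for a counterexample. Failure is what must respect pointwise equality, so
-- `resp` carries `Holds` backwards.
gallaiRamseyAt? : ∀ k m n N → Dec (GallaiRamseyAt k (𝓑 m) (𝓑 n) N)
gallaiRamseyAt? k m n N =
  map′ (λ none c → decidable-stable (holds? c) λ fails → none (c , fails))
       (λ all (c , fails) → fails (all c))
       (¬? (anyFunction? any? (λ c≗d fails holds → fails (resp c≗d holds)) (¬? ∘ holds?)))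
  where
  Holds : Coloring k N → Set
  Holds c = Exact c → HasRainbowCopy c (𝓑 m) ⊎ HasMonochromaticCopy c (𝓑 n)

  holds? : Decidable Holds
  holds? c = all? (λ i → anySubset? λ X → c X ≟ i) →-dec
             (hasRainbowCopy? c ⊎-dec hasMonochromaticCopy? c)

  resp : ∀ {c d} → c ≗ d → Holds d → Holds c
  resp {c} {d} c≗d holds exact = Sum.map
    (λ (f , f-inj) → f , λ cX≡cY → f-inj (trans (sym (c≗d _)) (trans cX≡cY (c≗d _))))
    (λ (f , f-mono) → f , λ X Y → trans (c≗d _) (trans (f-mono X Y) (sym (c≗d _))))
    (holds λ i → proj₁ (exact i) , trans (sym (c≗d _)) (proj₂ (exact i)))

-- Existence of the least threshold.

-- The known bound is lowered while `Q` holds just below it; the first failure rules out every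
-- smaller threshold.
least-threshold : {Q : ℕ → Set} → Decidable Q → ∀ b → (∀ N → b ≤ N → Q N) →
                  ∃[ g ] IsLeast (λ m → ∀ N → m ≤ N → Q N) g × g ≤ b
least-threshold Q? zero from = zero , (from , λ _ _ → z≤n) , z≤n
least-threshold {Q} Q? (suc b) from with Q? b
... | no ¬Qb = suc b , (from , λ m fromₘ → ℕ.≰⇒> λ m≤b → ¬Qb (fromₘ b m≤b)) , ≤-refl
... | yes Qb = let g , least , g≤b = least-threshold Q? b from′ in g , least , m≤n⇒m≤1+n g≤b
  where
  from′ : ∀ N → b ≤ N → Q N
  from′ N b≤N with ℕ.m≤n⇒m<n∨m≡n b≤N
  ... | inj₁ b<N = from N b<N
  ... | inj₂ refl = Qb

-- Counting colours of exact colourings.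

code : Subset N → Fin (2 ^ N)
code [] = zero
code (inside ∷ S) = combine {2} zero (code S)
code (outside ∷ S) = combine {2} (suc zero) (code S)

code-injective : (S T : Subset N) → code S ≡ code T → S ≡ T
code-injective [] [] _ = refl
code-injective (inside ∷ S) (inside ∷ T) e =
  cong (inside ∷_) (code-injective S T (proj₂ (combine-injective {2} zero _ zero _ e)))
code-injective (outside ∷ S) (outside ∷ T) e =
  cong (outside ∷_) (code-injective S T (proj₂ (combine-injective {2} (suc zero) _ (suc zero) _ e)))
code-injective (inside ∷ S) (outside ∷ T) e
  with () ← proj₁ (combine-injective {2} zero (code S) (suc zero) (code T) e)
code-injective (outside ∷ S) (inside ∷ T) e
  with () ← proj₁ (combine-injective {2} (suc zero) (code S) zero (code T) e)

-- A choice of one preimage per colour is injective, since `c` recovers the colour; with more than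
-- `2 ^ N` colours two preimages would share a code.
exact⇒≤2^ : (c : Coloring k N) → Exact c → k ≤ 2 ^ N
exact⇒≤2^ c exact = ℕ.≮⇒≥ λ 2^N<k →
  let i , j , i<j , eq = pigeonhole 2^N<k (code ∘ proj₁ ∘ exact) in
  <⇒≢ i<j (trans (sym (proj₂ (exact i)))
    (trans (cong c (code-injective _ _ eq)) (proj₂ (exact j))))

theorem1p4 : ∀ (k n : ℕ) → 4 ≤ k → 1 ≤ n → ∀ (r : ℕ) → IsR 3 (𝓑 n) r →
    (k ≤ 2 ^ (r + n) → ∃[ g ] (IsGR k (𝓑 2) (𝓑 n) g × g ≤ r + n))
    × (2 ^ (r + n) < k → Good k (𝓑 2) (𝓑 n))
theorem1p4 k n _ _ r (ramsey , _) =
  (λ _ → least-threshold (gallaiRamseyAt? k 2 n) (r + n) large) , good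
  where
  large : ∀ N → r + n ≤ N → GallaiRamseyAt k (𝓑 2) (𝓑 n) N
  large N r+n≤N c _ = rainbow-or-mono ramsey r+n≤N c

  good : 2 ^ (r + n) < k → Good k (𝓑 2) (𝓑 n)
  good 2^<k N _ c exact with ℕ.≤-total (r + n) N
  ... | inj₁ r+n≤N = large N r+n≤N c exact
  ... | inj₂ N≤r+n = contradiction
    (≤-trans (exact⇒≤2^ c exact) (ℕ.^-monoʳ-≤ 2 N≤r+n)) (ℕ.<⇒≱ 2^<k)
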